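{- Let $\mathcal{D}_S$ be a linked data structure storing $n$ multi-dimensional keys. If $\mathcal{D}_S$ invokes the k-Compare procedure $A(n)$ times during the course of an operation with target key $x$, then it can perform all comparison operations in $\mathcal{O}(A(n))$ span and $\mathcal{O}(k+A(n))$ work in CRCW PRAM, where $k$ is the dimensionality of the target key $x$.
   Context: Keys are sequences compared lexicographically; LCP means longest common prefix. For a node $v$ of $\mathcal{D}_S$, $\pi_v$ is the set of nodes traversed (before $v$) when searching for $v$, and $\pi_v^-,\pi_v^+$ are the immediate lexicographic predecessor and successor of $v$ in $\pi_v$ ($-\infty,\infty$ if none; LCP with these has length $0$). Each node $v$ stores the LCP lengths $\ell_{v,\pi_v^- }$ and $\ell_{v,\pi_v^+}$. During a search for $x$ arriving at $v$, with $\pi^\pm=\pi_v^\pm$, let the sign $\pm$ be $-$ if $x$ shares a longer LCP with $\pi^-$ than with $\pi^+$ and $+$ otherwise, and let $\ell_{x,\pi^\pm}$ be the corresponding LCP length; these are maintained during the search. Procedure k-Compare$(x,v,\pm,\ell_{x,\pi^\pm})$ returns the order of $x$ relative to $v$ ($+$: $x$ follows $v$; $-$: $x$ precedes $v$; or $=$) and an LCP length: if $\ell_{x,\pi^\pm}>\ell_{v,\pi^\pm}$, return $(\pm,\ell_{v,\pi^\pm})$; if $\ell_{x,\pi^\pm}<\ell_{v,\pi^\pm}$, return $(\mp,\ell_{x,\pi^\pm})$; otherwise compute $\ell_{x,v}=\ell_{x,\pi^\pm}+\mathrm{LCP}(x[\ell_{x,\pi^\pm}:k],\,v[\ell_{x,\pi^\pm}:k])$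 and return (the comparison of $x[\ell_{x,v}]$ with $v[\ell_{x,v}]$, $\ell_{x,v}$). Standing assumptions: a parallel LCP oracle is available that computes the LCP length of two $j$-dimensional keys in $\mathcal{O}(j)$ work and $\mathcal{O}(1)$ span, and $A(n)=\Theta(f(n))$ for a known function $f$. CRCW PRAM: concurrent-read concurrent-write PRAM; span is parallel time and work is total operations. -}

module Defs where

open import Data.Bool.Base using (Bool; true; false; if_then_else_)
open import Data.Fin.Base using (Fin; toℕ)
open import Data.List.Base using (List; []; _∷_; length; lookup; take; drop; filter)
open import Data.List.Relation.Binary.Lex.Strict using (<-strictTotalOrder)
open import Data.Maybe.Base using (Maybe; just; nothing; maybe)
open import Data.Nat.Base using (ℕ; zero; suc; _+_; _*_; _∸_; _/_; _≤_; _<_; _≡ᵇ_; _<ᵇ_)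
open import Data.Nat.Properties using (<-cmp; _<?_)
open import Data.Product.Base using (_×_; _,_; proj₁; proj₂; ∃-syntax)
open import Data.Sign.Base using (Sign; opposite)
open import Level using (Level; _⊔_; 0ℓ) renaming (suc to lsuc)
open import Relation.Binary.Bundles using (StrictTotalOrder)
open import Relation.Binary.Core using (Rel)
open import Relation.Binary.Definitions using (Decidable; tri<; tri≈; tri>)
open import Relation.Binary.PropositionalEquality.Core using (_≡_; _≢_)
open import Relation.Nullary.Decidable.Core using (does)

infix 4 _∈O_ _∈Θ_

_∈O_ : (ℕ → ℕ) → (ℕ → ℕ) → Set
g ∈O h = ∃[ c ] ∃[ N ] (∀ m → N ≤ m → g m ≤ c * h m)

_∈Θ_ : (ℕ → ℕ) → (ℕ → ℕ) → Set
g ∈Θ h = g ∈O h × h ∈O g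

infixl 6 _⊕_

record Cost : Set where
  constructor ⟨work:_,span:_⟩
  field
    work : ℕ
    span : ℕ

open Cost public

_⊕_ : Cost → Cost → Cost
⟨work: w ,span: s ⟩ ⊕ ⟨work: w′ ,span: s′ ⟩ = ⟨work: w + w′ ,span: s + s′ ⟩

steps : ℕ → Cost
steps m = ⟨work: m ,span: m ⟩

-- The cost of the parallel LCP oracle as a function of the dimension j of its
-- two arguments; what it computes is the `lcp` rule of `_⊢_⟶_∣_` below.
record LCPOracle : Set where
  field
    workOf   : ℕ → ℕ
    spanOf   : ℕ → ℕ
    workOf∈O : workOf ∈O (λ j → j)
    spanOf∈O : spanOf ∈O (λ _ → 1)

  costOf : ℕ → Cost
  costOf j = ⟨work: workOf j ,span: spanOf j ⟩

------------------------------------------------------------------------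
-- Programs of a CRCW PRAM with an LCP oracle, in the work–time presentation:
-- a program issues a sequence of steps, each of which is carried out by as
-- many processors as it asks for.  Expressions have a fixed size, so every
-- processor does a constant amount of work in a step.

Reg : Set
Reg = ℕ

data Op : Set where
  add monus mul div less same : Op

data Expr : Set where
  lit  : ℕ → Expr
  pid  : Expr                        -- index of the evaluating processor
  reg  : Reg → Expr
  load : Expr → Expr                 -- contents of a shared memory cell
  op   : Op → Expr → Expr → Expr

size : Expr → ℕ
size (lit _)     = 1
size pid         = 1
size (reg _)     = 1
size (load e)    = 1 + size e
size (op _ d e)  = 1 + size d + size e

infixr 5 _⨾_

data Program : Set where
  skip       : Program
  assign     : Reg → Expr → Program
  -- for 0 ≤ i < p in parallel: memory[a(i)] := e(i)
  par        : (p a e : Expr) → Program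
  -- assigns to a register the LCP length of the two j-dimensional keys that
  -- are stored from addresses a and b on
  lcp        : Reg → (a b j : Expr) → Program
  _⨾_        : Program → Program → Program
  ifNonzero  : Expr → Program → Program → Program
  whileNonzero : Expr → Program → Program

-- Registers through which a comparison communicates.  The first four are set
-- once, before the operation starts, the next three at every invocation.
xAddr dimension nodeCount known nodeAddr signIn lcpIn orderOut lcpOut : Reg
xAddr     = 0
dimension = 1
nodeCount = 2
known     = 3
nodeAddr  = 4
signIn    = 5
lcpIn     = 6
orderOut  = 7
lcpOut    = 8

-- `ord Sign.-`: x precedes v;  `ord Sign.+`: x follows v.
data Order : Set where
  ord : Sign → Order
  eq  : Order

signCode : Sign → ℕ
signCode Sign.- = 0
signCode Sign.+ = 1

orderCode : Order → ℕ
orderCode (ord s) = signCode s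
orderCode eq      = 2

module Comparisons {a ℓ₁ ℓ₂ : Level} (𝓐 : StrictTotalOrder a ℓ₁ ℓ₂) where

  module 𝓐 = StrictTotalOrder 𝓐
  module Lex = StrictTotalOrder (<-strictTotalOrder 𝓐)

  Key : Set a
  Key = List 𝓐.Carrier

  order : Key → Key → Order
  order x y with Lex.compare x y
  ... | tri< _ _ _ = ord Sign.-
  ... | tri≈ _ _ _ = eq
  ... | tri> _ _ _ = ord Sign.+

  LCP : Key → Key → ℕ
  LCP (b ∷ x) (c ∷ y) = if does (b 𝓐.≟ c) then suc (LCP x y) else 0
  LCP _       _       = 0

  infix 9 _[_∶_]
  _[_∶_] : Key → ℕ → ℕ → Key
  x [ i ∶ j ] = take (j ∸ i) (drop i x)

  ----------------------------------------------------------------------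
  -- Linked structures

  -- A search is at a position, which names the node whose key is compared
  -- next (`nothing`: the search is over) and, according to whether the target
  -- precedes or follows that key, holds a link to another position.  In a
  -- search tree positions are the links to nodes; in a skip list they are
  -- pairs of a node and a level.
  record Links (n : ℕ) : Set (a ⊔ lsuc 0ℓ) where
    field
      key      : Fin n → Key
      Position : Set
      entry    : Position
      node     : Position → Maybe (Fin n)
      link     : Position → Sign → Position

  -- The search for x gets to a position after traversing the listed nodes
  -- (last one first), none of which has key x.
  data Reaches {n} (L : Links n) (x : Key) :
               Links.Position L → List (Fin n) → Set where
    enter  : Reaches L x (Links.entry L) []
    follow : ∀ {p vs v s} → Reaches L x p vs → Links.node L p ≡ just v →
             order x (Links.key L v) ≡ ord s →
             Reaches L x (Links.link L p s) (v ∷ vs)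

  record LinkedStructure (n : ℕ) : Set (a ⊔ lsuc 0ℓ) where
    field
      links : Links n
    open Links links public
    field
      -- The search for a stored key finds its node; in particular different
      -- nodes have different keys.
      access : ∀ v → ∃[ p ] ∃[ vs ] (Reaches links (key v) p vs × node p ≡ just v)
      -- Any search that arrives at v does so along the access path of v.
      path   : ∀ {x p vs v} → Reaches links x p vs → node p ≡ just v →
               Reaches links (key v) p vs

    π : Fin n → List (Fin n)
    π v = proj₁ (proj₂ (access v))

    -- The largest element of a list with respect to R.
    largest : {R : Rel (Fin n) (a ⊔ ℓ₁ ⊔ ℓ₂)} → Decidable R →
              List (Fin n) → Maybe (Fin n)
    largest R? []       = nothing
    largest R? (u ∷ us) =
      just (maybe (λ w → if does (R? u w) then w else u) u (largest R? us))

    -- `nothing` stands for −∞ and ∞.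
    πᵖ : Sign → Fin n → Maybe (Fin n)
    πᵖ Sign.- v = largest (λ u w → key u Lex.<? key w)
                          (filter (λ u → key u Lex.<? key v) (π v))
    πᵖ Sign.+ v = largest (λ u w → key w Lex.<? key u)
                          (filter (λ u → key v Lex.<? key u) (π v))

    ℓ : Key → Maybe (Fin n) → ℕ
    ℓ x = maybe (λ u → LCP x (key u)) 0

    signAt : Key → Fin n → Sign
    signAt x v = if does (ℓ x (πᵖ Sign.+ v) <? ℓ x (πᵖ Sign.- v))
                 then Sign.- else Sign.+

    kCompare : Key → Fin n → Sign → ℕ → Order × ℕ
    kCompare x v s ℓₓ with <-cmp ℓₓ (ℓ (key v) (πᵖ s v))
    ... | tri> _ _ _ = ord s , ℓ (key v) (πᵖ s v)
    ... | tri< _ _ _ = ord (opposite s) , ℓₓ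
    ... | tri≈ _ _ _ = order (x [ m ∶ suc m ]) (key v [ m ∶ suc m ]) , m
      -- comparing slices of length one, the end of a key precedes every letter
      where
      k = length x
      m = ℓₓ + LCP (x [ ℓₓ ∶ k ]) (key v [ ℓₓ ∶ k ])

    -- The nodes (last one first) whose keys the search for x has been
    -- compared with when it, or the operation containing it, ends: the search
    -- may end with any comparison.
    data Compares (x : Key) : List (Fin n) → Set where
      none  : Compares x []
      until : ∀ {p vs v} → Reaches links x p vs → node p ≡ just v →
              Compares x (v ∷ vs)

  ----------------------------------------------------------------------
  -- Execution of programs

  data Word : Set a where
    num : ℕ → Word
    sym : 𝓐.Carrier → Word

  toNum : Word → ℕ
  toNum (num m) = m
  toNum (sym _) = 0

  record Store : Set a where
    constructor store
    field
      regs   : Reg → Word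
      memory : ℕ → Word

  open Store public

  _[_≔_] : Store → Reg → Word → Store
  regs   (σ [ r ≔ w ]) q = if q ≡ᵇ r then w else regs σ q
  memory (σ [ r ≔ w ])   = memory σ

  bit : Bool → Word
  bit b = num (if b then 1 else 0)

  quot : ℕ → ℕ → ℕ
  quot m zero    = 0
  quot m (suc d) = m / suc d

  apply : Op → Word → Word → Word
  apply add   v       w       = num (toNum v + toNum w)
  apply monus v       w       = num (toNum v ∸ toNum w)
  apply mul   v       w       = num (toNum v * toNum w)
  apply div   v       w       = num (quot (toNum v) (toNum w))
  apply less  (num l) (num m) = bit (l <ᵇ m)
  apply less  (sym b) (sym c) = bit (does (b 𝓐.<? c))
  apply less  _       _       = bit false
  apply same  (num l) (num m) = bit (l ≡ᵇ m)
  apply same  (sym b) (sym c) = bit (does (b 𝓐.≟ c))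
  apply same  _       _       = bit false

  -- The value of an expression for processor i.
  eval : Store → ℕ → Expr → Word
  eval σ i (lit m)    = num m
  eval σ i pid        = num i
  eval σ i (reg r)    = regs σ r
  eval σ i (load e)   = memory σ (toNum (eval σ i e))
  eval σ i (op o d e) = apply o (eval σ i d) (eval σ i e)

  -- The value of an expression as a number, for the only active processor.
  val : Store → Expr → ℕ
  val σ e = toNum (eval σ 0 e)

  Holds : (ℕ → Word) → ℕ → Key → Set a
  Holds m b x = ∀ i → m (b + toℕ i) ≡ sym (lookup x i)

  module _ (oracle : LCPOracle) where
    open LCPOracle oracle

    data _⊢_⟶_∣_ : Program → Store → Store → Cost → Set a where

      skip : ∀ {σ} → skip ⊢ σ ⟶ σ ∣ steps 0

      assign : ∀ {σ r e} →
               assign r e ⊢ σ ⟶ σ [ r ≔ eval σ 0 e ] ∣ steps (1 + size e)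

      -- Writes take place after all reads.  Concurrent writes follow the
      -- Common rule: no transition exists if two processors write different
      -- words to one cell.  A program that runs under it also runs, with the
      -- same effect, under the Arbitrary and Priority rules.
      par : ∀ {σ p a e m} → let P = val σ p in
            (∀ i → i < P → m (toNum (eval σ i a)) ≡ eval σ i e) →
            (∀ b → (∀ i → i < P → toNum (eval σ i a) ≢ b) → m b ≡ memory σ b) →
            par p a e ⊢ σ ⟶ store (regs σ) m ∣
              (steps (size p) ⊕ ⟨work: P * (1 + size a + size e)
                                ,span: 1 + size a + size e ⟩)

      lcp : ∀ {σ r a b j} {y z : Key} →
            length y ≡ val σ j → Holds (memory σ) (val σ a) y →
            length z ≡ val σ j → Holds (memory σ) (val σ b) z →
            lcp r a b j ⊢ σ ⟶ σ [ r ≔ num (LCP y z) ] ∣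
              (steps (1 + size a + size b + size j) ⊕ costOf (val σ j))

      _⨾_ : ∀ {P Q σ σ′ σ″ c d} →
            P ⊢ σ ⟶ σ′ ∣ c → Q ⊢ σ′ ⟶ σ″ ∣ d → (P ⨾ Q) ⊢ σ ⟶ σ″ ∣ (c ⊕ d)

      if-yes : ∀ {e P Q σ σ′ c m} → val σ e ≡ suc m → P ⊢ σ ⟶ σ′ ∣ c →
               ifNonzero e P Q ⊢ σ ⟶ σ′ ∣ (steps (1 + size e) ⊕ c)

      if-no : ∀ {e P Q σ σ′ c} → val σ e ≡ 0 → Q ⊢ σ ⟶ σ′ ∣ c →
              ifNonzero e P Q ⊢ σ ⟶ σ′ ∣ (steps (1 + size e) ⊕ c)

      while-yes : ∀ {e P σ σ′ σ″ c d m} → val σ e ≡ suc m → P ⊢ σ ⟶ σ′ ∣ c →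
                  whileNonzero e P ⊢ σ′ ⟶ σ″ ∣ d →
                  whileNonzero e P ⊢ σ ⟶ σ″ ∣ (steps (1 + size e) ⊕ c ⊕ d)

      while-no : ∀ {e P σ} → val σ e ≡ 0 →
                 whileNonzero e P ⊢ σ ⟶ σ ∣ steps (1 + size e)

  ----------------------------------------------------------------------
  -- Performing the comparisons of an operation

  module _ {n : ℕ} (D : LinkedStructure n) (x : Key) where
    open LinkedStructure D

    -- The target x is in memory at address b.  The record of node v is at
    -- address addr v: its two LCP lengths, the dimension of its key, its key.
    record InMemory (addr : Fin n → ℕ) (b : ℕ) (m : ℕ → Word) : Set a where
      field
        target : Holds m b x
        lcps   : ∀ v s → m (addr v + signCode s) ≡ num (ℓ (key v) (πᵖ s v))
        dim    : ∀ v → m (addr v + 2) ≡ num (length (key v))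
        keys   : ∀ v → Holds m (addr v + 3) (key v)

    -- fₙ is the value at n of the function known to the program.
    record Initial (addr : Fin n → ℕ) (b fₙ : ℕ) (σ : Store) : Set a where
      field
        inMemory    : InMemory addr b (memory σ)
        xAddr≡      : regs σ xAddr     ≡ num b
        dimension≡  : regs σ dimension ≡ num (length x)
        nodeCount≡  : regs σ nodeCount ≡ num n
        known≡      : regs σ known     ≡ num fₙ

    lcpAt : Fin n → ℕ
    lcpAt v = ℓ x (πᵖ (signAt x v) v)

    pass : (addr : Fin n → ℕ) → Fin n → Store → Store
    pass addr v σ = σ [ nodeAddr ≔ num (addr v) ]
                      [ signIn   ≔ num (signCode (signAt x v)) ]
                      [ lcpIn    ≔ num (lcpAt v) ]

    -- P, run once for each of the listed nodes (last one first), returns what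
    -- k-Compare returns and leaves x and the structure intact.
    data Performs (oracle : LCPOracle) (P : Program) (addr : Fin n → ℕ) (b : ℕ)
                  (σ : Store) : List (Fin n) → Store → Cost → Set a where
      done : Performs oracle P addr b σ [] σ (steps 0)
      next : ∀ {vs v τ τ′ c d} → Performs oracle P addr b σ vs τ c →
             _⊢_⟶_∣_ oracle P (pass addr v τ) τ′ d →
             let r = kCompare x v (signAt x v) (lcpAt v) in
             regs τ′ orderOut ≡ num (orderCode (proj₁ r)) →
             regs τ′ lcpOut ≡ num (proj₂ r) →
             InMemory addr b (memory τ′) →
             Performs oracle P addr b σ (v ∷ vs) τ′ (c ⊕ d)

module Submission where

-- The keys are compared in chunks of 1 + ⌊k / f(n)⌋ letters.  Each call of
-- k-Compare examines at most one chunk that does not match entirely.  The chunks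
-- that do match are paid for by a potential, the longest LCP of x with a key
-- compared so far: it is at most k, so only f(n) = Θ(A(n)) chunks match in total,
-- and the O(A(n)) chunks examined have O(k + A(n)) letters altogether.

open import Defs
open import Data.Bool.Base using (if_then_else_)
open import Data.Empty using (⊥)
open import Data.Fin.Base using (Fin; toℕ; zero; suc)
open import Data.List.Base using (List; []; _∷_; length; take; drop; filter; foldr)
open import Data.List.Membership.Propositional using (_∈_)
open import Data.List.Membership.Propositional.Properties using (∈-filter⁺)
open import Data.List.Properties using (length-take; length-drop)
open import Data.List.Relation.Binary.Lex.Core using (halt; this; next)
open import Data.List.Relation.Unary.All using (All; []; _∷_)
open import Data.List.Relation.Unary.All.Properties using (all-filter)
open import Data.List.Relation.Unary.Any using (here; there)
open import Data.Maybe.Base using (just; nothing)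
open import Data.Nat.Base
open import Data.Nat.DivMod using (m≡m%n+[m/n]*n; m/n*n≤m; m%n<n)
open import Data.Nat.Properties
open import Data.Product.Base using (_×_; _,_; proj₁; proj₂; ∃-syntax)
open import Data.Sign.Base using (Sign; opposite)
open import Data.Sum.Base using (_⊎_; inj₁; inj₂)
open import Level using (Level)
open import Relation.Binary.Bundles using (StrictTotalOrder)
open import Relation.Binary.Core using (Rel)
open import Relation.Binary.Definitions using (Decidable; Tri; tri<; tri≈; tri>)
open import Relation.Binary.PropositionalEquality
  using (_≡_; refl; sym; trans; cong; cong₂; subst; module ≡-Reasoning)
open import Relation.Nullary using (¬_; Dec; yes; no; contradiction)
open import Relation.Nullary.Decidable using (dec-true; dec-false)

-- Both extremes fail: one oracle call on all remaining letters can cost work of order k although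
-- the keys differ at once, and going letter by letter can cost span of order k. A chunk length near
-- k / f(n) balances the two, and it is computable in advance because f(n), unlike the number of
-- calls still to come, is available to the program. The delicate point is that the potential really
-- pays. The LCP length handed to a call refers to the neighbours of v on its search path, not to
-- all keys compared so far. What saves the argument is that as soon as a call matches a letter
-- beyond that length, no key compared earlier can share more than that length with x. Every letter
-- matched is therefore new to the whole search, and no position of x is matched twice.

-- Common prefixes and the lexicographic order

module CommonPrefixes {a ℓ₁ ℓ₂} (𝓐 : StrictTotalOrder a ℓ₁ ℓ₂) where
  open Comparisons 𝓐 renaming (sym to letter)

  LCP-sym : ∀ x y → LCP x y ≡ LCP y x
  LCP-sym []      []      = refl
  LCP-sym []      (_ ∷ _) = refl
  LCP-sym (_ ∷ _) []      = refl
  LCP-sym (b ∷ x) (c ∷ y) with b 𝓐.≟ c | c 𝓐.≟ b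
  ... | yes _   | yes _   = cong suc (LCP-sym x y)
  ... | no _    | no _    = refl
  ... | yes b≈c | no c≉b  = contradiction (𝓐.Eq.sym b≈c) c≉b
  ... | no b≉c  | yes c≈b = contradiction (𝓐.Eq.sym c≈b) b≉c

  -- Agreeing on the first `t` letters is transitive. The bound `t` replaces a minimum of two LCP
  -- lengths, so that the lemma also serves strict inequalities.
  LCP-ultrametric : ∀ x y z {t} → t ≤ LCP x y → t ≤ LCP y z → t ≤ LCP x z
  LCP-ultrametric _ _ _ {zero} _ _ = z≤n
  LCP-ultrametric (b ∷ x) (c ∷ y) (d ∷ z) {suc t} p q
    with b 𝓐.≟ c | c 𝓐.≟ d | b 𝓐.≟ d
  ... | yes b≈c | yes c≈d | no b≉d = contradiction (𝓐.Eq.trans b≈c c≈d) b≉d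
  LCP-ultrametric (b ∷ x) (c ∷ y) (d ∷ z) {suc t} (s≤s p) (s≤s q)
      | yes b≈c | yes c≈d | yes _  = s≤s (LCP-ultrametric x y z p q)

  LCP≤lengthˡ : ∀ x y → LCP x y ≤ length x
  LCP≤lengthˡ []      _       = z≤n
  LCP≤lengthˡ (_ ∷ _) []      = z≤n
  LCP≤lengthˡ (b ∷ x) (c ∷ y) with b 𝓐.≟ c
  ... | yes _ = s≤s (LCP≤lengthˡ x y)
  ... | no _  = z≤n

  LCP≤lengthʳ : ∀ x y → LCP x y ≤ length y
  LCP≤lengthʳ x y = subst (_≤ length y) (LCP-sym y x) (LCP≤lengthˡ y x)

  LCP-drop : ∀ m x y → m ≤ LCP x y → m + LCP (drop m x) (drop m y) ≡ LCP x y
  LCP-drop zero    _       _       _ = refl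
  LCP-drop (suc m) (b ∷ x) (c ∷ y) p with b 𝓐.≟ c
  LCP-drop (suc m) (b ∷ x) (c ∷ y) (s≤s p) | yes _ = cong suc (LCP-drop m x y p)

  LCP-take : ∀ j x y → LCP (take j x) (take j y) ≡ j ⊓ LCP x y
  LCP-take zero    _       _       = refl
  LCP-take (suc _) []      _       = refl
  LCP-take (suc _) (_ ∷ _) []      = refl
  LCP-take (suc j) (b ∷ x) (c ∷ y) with b 𝓐.≟ c
  ... | yes _ = cong suc (LCP-take j x y)
  ... | no _  = refl

  -- With x ≤ y < z, the key y is squeezed between x and z and so begins with every prefix that
  -- these two share. The negated hypothesis is the form in which a failed test of `largest`
  -- supplies x ≤ y.
  LCP-monoˡ-below : ∀ x y z → ¬ (y Lex.< x) → y Lex.< z → LCP x z ≤ LCP y z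
  LCP-monoˡ-below []      _       _       _   _ = z≤n
  LCP-monoˡ-below (_ ∷ _) _       []      _   _ = z≤n
  LCP-monoˡ-below (_ ∷ _) []      (_ ∷ _) y≮x _ = contradiction halt y≮x
  LCP-monoˡ-below (b ∷ x) (c ∷ y) (d ∷ z) y≮x y<z with b 𝓐.≟ d | y<z
  ... | no _    | _        = z≤n
  ... | yes b≈d | this c<d =
        contradiction (this (𝓐.<-respʳ-≈ (𝓐.Eq.sym b≈d) c<d)) y≮x
  ... | yes b≈d | next c≈d y<z′ with c 𝓐.≟ d
  ...   | no c≉d = contradiction c≈d c≉d
  ...   | yes _  = s≤s (LCP-monoˡ-below x y z
                         (λ p → y≮x (next (𝓐.Eq.trans c≈d (𝓐.Eq.sym b≈d)) p)) y<z′)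

  LCP-monoˡ-above : ∀ x y z → ¬ (x Lex.< y) → z Lex.< y → LCP x z ≤ LCP y z
  LCP-monoˡ-above []      _       _       _   _ = z≤n
  LCP-monoˡ-above (_ ∷ _) _       []      _   _ = z≤n
  LCP-monoˡ-above (_ ∷ _) []      (_ ∷ _) _ ()
  LCP-monoˡ-above (b ∷ x) (c ∷ y) (d ∷ z) x≮y z<y with b 𝓐.≟ d | z<y
  ... | no _    | _        = z≤n
  ... | yes b≈d | this d<c =
        contradiction (this (𝓐.<-respˡ-≈ (𝓐.Eq.sym b≈d) d<c)) x≮y
  ... | yes b≈d | next d≈c z<y′ with c 𝓐.≟ d
  ...   | no c≉d = contradiction (𝓐.Eq.sym d≈c) c≉d
  ...   | yes _  = s≤s (LCP-monoˡ-above x y z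
                         (λ p → x≮y (next (𝓐.Eq.trans b≈d d≈c) p)) z<y′)

  order-≈ : ∀ {x y} → x Lex.≈ y → order x y ≡ eq
  order-≈ {x} {y} x≈y with Lex.compare x y
  ... | tri< _ x≉y _ = contradiction x≈y x≉y
  ... | tri≈ _ _ _   = refl
  ... | tri> _ x≉y _ = contradiction x≈y x≉y

  order-ord : ∀ {x y s} → order x y ≡ ord s → y Lex.< x ⊎ x Lex.< y
  order-ord {x} {y} _ with Lex.compare x y
  ... | tri< x<y _ _ = inj₂ x<y
  ... | tri> _ _ y<x = inj₁ y<x

-- Search paths, their neighbours of a node, and the potential

module Searches {a ℓ₁ ℓ₂} (𝓐 : StrictTotalOrder a ℓ₁ ℓ₂)
                {n} (D : Comparisons.LinkedStructure 𝓐 n) where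
  open Comparisons 𝓐 renaming (sym to letter)
  open CommonPrefixes 𝓐
  open LinkedStructure D

  same-length : ∀ {x p p′ vs vs′} → Reaches links x p vs → Reaches links x p′ vs′ →
                length vs ≡ length vs′ → p ≡ p′ × vs ≡ vs′
  same-length enter enter _ = refl , refl
  same-length (follow r np o) (follow r′ np′ o′) e
    with same-length r r′ (suc-injective e)
  ... | refl , refl with trans (sym np) np′
  ...   | refl with trans (sym o) o′
  ...     | refl = refl , refl

  -- A search leaves a node only after a comparison other than `eq`, so a search that has met its
  -- own target has no longer continuation; searches of equal length agree because links are
  -- deterministic.
  stuck : ∀ {x p p′ v vs vs′} → Reaches links x p vs → node p ≡ just v →
          order x (key v) ≡ eq → Reaches links x p′ vs′ →
          length vs ≤ length vs′ → p ≡ p′ × vs ≡ vs′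
  stuck r np o r′ le with m≤n⇒m<n∨m≡n le
  stuck r np o r′ le | inj₂ e = same-length r r′ e
  stuck r np o (follow r′ np′ o′) le | inj₁ lt with stuck r np o r′ (s≤s⁻¹ lt)
  ... | refl , refl with trans (sym np) np′
  ...   | refl with trans (sym o) o′
  ...     | ()

  -- By `path`, the list `vs` also belongs to the search for `key v`. Neither this search nor the
  -- one chosen by `access` can continue past v, so the shorter of the two is all of the longer.
  path≡π : ∀ {x p vs v} → Reaches links x p vs → node p ≡ just v → vs ≡ π v
  path≡π {vs = vs} {v} r np with access v | path r np
  ... | p′ , us , r″ , np″ | r′ with ≤-total (length vs) (length us)
  ...   | inj₁ le = proj₂ (stuck r′ np (order-≈ Lex.Eq.refl) r″ le)
  ...   | inj₂ le = sym (proj₂ (stuck r″ np″ (order-≈ Lex.Eq.refl) r′ le))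

  reached≢ : ∀ {x p vs u} → Reaches links x p vs → u ∈ vs →
             key u Lex.< x ⊎ x Lex.< key u
  reached≢ (follow r _ o) (here refl) = order-ord o
  reached≢ (follow r _ _) (there u∈)  = reached≢ r u∈

  -- Here `g` will be the LCP length with a fixed key and `Q` the property of lying on a given side
  -- of that key. On one side, closeness to the key and `g` grow together: `up` serves the case that
  -- `largest` keeps its candidate, `down` the case that it replaces it.
  largest-maximises : ∀ {R : Rel (Fin n) _} (R? : Decidable R)
    (g : Fin n → ℕ) (Q : Fin n → Set (a Level.⊔ ℓ₁ Level.⊔ ℓ₂)) →
    (∀ {u w} → Q w → R u w → g u ≤ g w) →
    (∀ {u w} → Q u → ¬ R u w → g w ≤ g u) →
    ∀ us → All Q us →
    (us ≡ [] × largest R? us ≡ nothing) ⊎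
    ∃[ w ] (largest R? us ≡ just w × Q w × (∀ {u} → u ∈ us → g u ≤ g w))
  largest-maximises R? g Q up down []       []        = inj₁ (refl , refl)
  largest-maximises R? g Q up down (u ∷ us) (qu ∷ qs)
    with largest R? us | largest-maximises R? g Q up down us qs
  ... | _ | inj₁ (refl , refl) = inj₂ (u , refl , qu , λ { (here refl) → ≤-refl })
  ... | _ | inj₂ (w , refl , qw , max) with R? u w
  ...   | yes ruw = inj₂ (w , refl , qw ,
                          λ { (here refl) → up qw ruw ; (there u∈) → max u∈ })
  ...   | no ¬ruw = inj₂ (u , refl , qu ,
                          λ { (here refl) → ≤-refl
                            ; (there u∈) → ≤-trans (max u∈) (down qu ¬ruw) })

  largest-filter : ∀ {R : Rel (Fin n) _} (R? : Decidable R)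
    (g : Fin n → ℕ) {Q : Fin n → Set (a Level.⊔ ℓ₁ Level.⊔ ℓ₂)} (Q? : ∀ u → Dec (Q u)) →
    (∀ {u w} → Q w → R u w → g u ≤ g w) →
    (∀ {u w} → Q u → ¬ R u w → g w ≤ g u) →
    ∀ us {u} → u ∈ us → Q u →
    ∃[ w ] (largest R? (filter Q? us) ≡ just w × g u ≤ g w)
  largest-filter R? g Q? up down us u∈ qu
    with ∈-filter⁺ Q? u∈ qu
       | largest-maximises R? g _ up down (filter Q? us) (all-filter Q? us)
  ... | u∈′ | inj₁ (us≡[] , _)       with () ← subst (_ ∈_) us≡[] u∈′
  ... | u∈′ | inj₂ (w , w≡ , _ , max) = w , w≡ , max u∈′

  -- The neighbour of v on the side of u is u itself or lies between u and v, hence it shares with v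
  -- whatever u shares with v.
  nearest-shares-longest : ∀ {u v} → u ∈ π v → key u Lex.< key v ⊎ key v Lex.< key u →
    ∃[ s ] ∃[ w ] (πᵖ s v ≡ just w × LCP (key u) (key v) ≤ LCP (key w) (key v))
  nearest-shares-longest {v = v} u∈ (inj₁ u<v) =
    Sign.- , largest-filter (λ u w → key u Lex.<? key w) (λ u → LCP (key u) (key v))
               (λ u → key u Lex.<? key v)
               (λ w<v u<w → LCP-monoˡ-below _ _ _ (Lex.asym u<w) w<v)
               (λ u<v u≮w → LCP-monoˡ-below _ _ _ u≮w u<v)
               (π v) u∈ u<v
  nearest-shares-longest {v = v} u∈ (inj₂ v<u) =
    Sign.+ , largest-filter (λ u w → key w Lex.<? key u) (λ u → LCP (key u) (key v))
               (λ u → key v Lex.<? key u)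
               (λ v<w w<u → LCP-monoˡ-above _ _ _ (Lex.asym w<u) v<w)
               (λ v<u w≮u → LCP-monoˡ-above _ _ _ w≮u v<u)
               (π v) u∈ v<u

  longest : Key → List (Fin n) → ℕ
  longest x = foldr (λ u m → LCP x (key u) ⊔ m) 0

  longest≤length : ∀ x vs → longest x vs ≤ length x
  longest≤length x []       = z≤n
  longest≤length x (v ∷ vs) = ⊔-lub (LCP≤lengthˡ x (key v)) (longest≤length x vs)

  longest-lub : ∀ x vs {t} → (∀ {u} → u ∈ vs → LCP x (key u) ≤ t) → longest x vs ≤ t
  longest-lub x []       _ = z≤n
  longest-lub x (v ∷ vs) h = ⊔-lub (h (here refl)) (longest-lub x vs (λ u∈ → h (there u∈)))

  ℓ≤lcpAt : ∀ x v s → ℓ x (πᵖ s v) ≤ lcpAt D x v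
  ℓ≤lcpAt x v s with ℓ x (πᵖ Sign.+ v) <? ℓ x (πᵖ Sign.- v)
  ... | yes lt = subst (λ b → ℓ x (πᵖ s v) ≤ ℓ x (πᵖ (if b then Sign.- else Sign.+) v))
                       (sym (dec-true (_ <? _) lt)) (below s)
    where
    below : ∀ s → ℓ x (πᵖ s v) ≤ ℓ x (πᵖ Sign.- v)
    below Sign.- = ≤-refl
    below Sign.+ = <⇒≤ lt
  ... | no ≮   = subst (λ b → ℓ x (πᵖ s v) ≤ ℓ x (πᵖ (if b then Sign.- else Sign.+) v))
                       (sym (dec-false (_ <? _) ≮)) (above s)
    where
    above : ∀ s → ℓ x (πᵖ s v) ≤ ℓ x (πᵖ Sign.+ v)
    above Sign.- = ≮⇒≥ ≮
    above Sign.+ = ≤-refl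

  -- If u shared more than lcpAt with x, it would do so with v, and then so
  -- would the neighbour of v on the side of u, hence that neighbour with x.
  longest≤lcpAt : ∀ {x p vs v} → Reaches links x p vs → node p ≡ just v →
                  lcpAt D x v < LCP x (key v) → longest x vs ≤ lcpAt D x v
  longest≤lcpAt {x} {vs = vs} {v} r np lt = longest-lub x vs bound
    where
    bound : ∀ {u} → u ∈ vs → LCP x (key u) ≤ lcpAt D x v
    bound {u} u∈ = ≮⇒≥ λ lt′ →
      let s , w , w≡ , le = nearest-shares-longest (subst (u ∈_) (path≡π r np) u∈)
                                                   (reached≢ (path r np) u∈)
          uv = LCP-ultrametric (key u) x (key v)
                 (≤-trans lt′ (≤-reflexive (LCP-sym x (key u)))) lt
          xw = LCP-ultrametric x (key v) (key w) lt
                 (≤-trans uv (≤-trans le (≤-reflexive (LCP-sym (key w) (key v)))))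
      in <⇒≱ xw (subst (λ w → ℓ x w ≤ lcpAt D x v) w≡ (ℓ≤lcpAt x v s))

  -- The potential never decreases, which settles t = 0. For positive t the call got beyond `lcpAt`,
  -- so by `longest≤lcpAt` the old potential is at most `lcpAt`, and the t letters found lie above
  -- it.
  longest-advances : ∀ {x p vs v t} → Reaches links x p vs → node p ≡ just v →
                     t ≡ 0 ⊎ lcpAt D x v + t ≤ LCP x (key v) →
                     t + longest x vs ≤ longest x (v ∷ vs)
  longest-advances {x} {v = v} r np (inj₁ refl) = m≤n⊔m (LCP x (key v)) _
  longest-advances {x} {v = v} {zero} r np (inj₂ _) = m≤n⊔m (LCP x (key v)) _
  longest-advances {x} {vs = vs} {v} {suc t} r np (inj₂ le) = begin
    suc t + longest x vs    ≤⟨ +-monoʳ-≤ (suc t) (longest≤lcpAt r np (≤-trans (m<m+n _ z<s) le)) ⟩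
    suc t + lcpAt D x v     ≡⟨ +-comm (suc t) _ ⟩
    lcpAt D x v + suc t     ≤⟨ le ⟩
    LCP x (key v)           ≤⟨ m≤m⊔n _ _ ⟩
    longest x (v ∷ vs)      ∎
    where open ≤-Reasoning

  -- In a tie, x and v agree equally far with the same neighbour, hence at least as far with each
  -- other. This allows the scan to start at `lcpAt` instead of at the first letter.
  lcpAt≤LCP : ∀ x v → lcpAt D x v ≡ ℓ (key v) (πᵖ (signAt x v) v) →
              lcpAt D x v ≤ LCP x (key v)
  lcpAt≤LCP x v tie with πᵖ (signAt x v) v
  ... | nothing = z≤n
  ... | just w  = LCP-ultrametric x (key w) (key v) ≤-refl
                    (≤-reflexive (trans tie (LCP-sym (key v) (key w))))

  -- Cutting the key of v at the length of x loses nothing, since the common prefix ends there at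
  -- the latest.
  slices : ∀ ℓₓ x y → ℓₓ ≤ LCP x y →
           ℓₓ + LCP (x [ ℓₓ ∶ length x ]) (y [ ℓₓ ∶ length x ]) ≡ LCP x y
  slices ℓₓ x y le = begin
    ℓₓ + LCP (x [ ℓₓ ∶ length x ]) (y [ ℓₓ ∶ length x ])
      ≡⟨ cong (ℓₓ +_) (LCP-take (length x ∸ ℓₓ) (drop ℓₓ x) (drop ℓₓ y)) ⟩
    ℓₓ + ((length x ∸ ℓₓ) ⊓ LCP (drop ℓₓ x) (drop ℓₓ y))
      ≡⟨ cong (ℓₓ +_) (m≥n⇒m⊓n≡n (≤-trans (LCP≤lengthˡ (drop ℓₓ x) (drop ℓₓ y))
                                          (≤-reflexive (length-drop ℓₓ x)))) ⟩
    ℓₓ + LCP (drop ℓₓ x) (drop ℓₓ y)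
      ≡⟨ LCP-drop ℓₓ x y le ⟩
    LCP x y ∎
    where open ≡-Reasoning

  kCompare-> : ∀ x v s {ℓₓ} → ℓ (key v) (πᵖ s v) < ℓₓ →
               kCompare x v s ℓₓ ≡ (ord s , ℓ (key v) (πᵖ s v))
  kCompare-> x v s {ℓₓ} lt with <-cmp ℓₓ (ℓ (key v) (πᵖ s v))
  ... | tri< _ _ ≯ = contradiction lt ≯
  ... | tri≈ _ _ ≯ = contradiction lt ≯
  ... | tri> _ _ _ = refl

  kCompare-< : ∀ x v s {ℓₓ} → ℓₓ < ℓ (key v) (πᵖ s v) →
               kCompare x v s ℓₓ ≡ (ord (opposite s) , ℓₓ)
  kCompare-< x v s {ℓₓ} lt with <-cmp ℓₓ (ℓ (key v) (πᵖ s v))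
  ... | tri< _ _ _ = refl
  ... | tri≈ ≮ _ _ = contradiction lt ≮
  ... | tri> ≮ _ _ = contradiction lt ≮

  kCompare-≡ : ∀ x v s {ℓₓ} → ℓₓ ≡ ℓ (key v) (πᵖ s v) → ℓₓ ≤ LCP x (key v) →
               let m = LCP x (key v) in
               kCompare x v s ℓₓ ≡ (order (x [ m ∶ suc m ]) (key v [ m ∶ suc m ]) , m)
  kCompare-≡ x v s {ℓₓ} tie le with <-cmp ℓₓ (ℓ (key v) (πᵖ s v))
  ... | tri< _ ≢ _ = contradiction tie ≢
  ... | tri> _ ≢ _ = contradiction tie ≢
  ... | tri≈ _ _ _ =
        cong (λ m → order (x [ m ∶ suc m ]) (key v [ m ∶ suc m ]) , m) (slices ℓₓ x (key v) le)

-- Asymptotic bounds and truncated subtraction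

-- The oracle is called on short chunks however large n is, so a bound valid only for large
-- arguments would not do. The finitely many exceptions go into the additive constant.
eventually⇒everywhere : ∀ {g h} → g ∈O h → ∃[ c ] ∃[ K ] (∀ m → g m ≤ c * h m + K)
eventually⇒everywhere {g} {h} (c , N , large) = c , proj₁ (below N) , bound
  where
  below : ∀ N → ∃[ K ] (∀ m → m < N → g m ≤ K)
  below zero    = 0 , λ _ ()
  below (suc N) with below N
  ... | K , small = g N ⊔ K , λ m m<1+N → case m (m≤n⇒m<n∨m≡n (s≤s⁻¹ m<1+N))
    where
    case : ∀ m → m < N ⊎ m ≡ N → g m ≤ g N ⊔ K
    case m (inj₁ m<N)  = ≤-trans (small m m<N) (m≤n⊔m (g N) K)
    case m (inj₂ refl) = m≤m⊔n (g N) K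

  bound : ∀ m → g m ≤ c * h m + proj₁ (below N)
  bound m with m <? N
  ... | yes m<N = ≤-trans (proj₂ (below N) m m<N) (m≤n+m _ (c * h m))
  ... | no m≮N  = ≤-trans (large m (≮⇒≥ m≮N)) (m≤m+n _ _)

m∸[m∸n]≡m⊓n : ∀ m n → m ∸ (m ∸ n) ≡ m ⊓ n
m∸[m∸n]≡m⊓n m n with ≤-total m n
... | inj₁ m≤n = trans (cong (m ∸_) (m≤n⇒m∸n≡0 m≤n)) (sym (m≤n⇒m⊓n≡m m≤n))
... | inj₂ n≤m = trans (m∸[m∸n]≡n n≤m) (sym (m≥n⇒m⊓n≡n n≤m))

m∸n≡0⇒≮ : ∀ {m n} → 0 ≡ m ∸ n → ¬ (n < m)
m∸n≡0⇒≮ {m} {n} e n<m = <-irrefl e (m<n⇒0<n∸m n<m)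

m∸n≡1+⇒< : ∀ {m n l} → suc l ≡ m ∸ n → n < m
m∸n≡1+⇒< {m} {n} e = m∸n≢0⇒n<m (λ e′ → case (trans e e′))
  where
  case : ∀ {l} → suc l ≡ 0 → ⊥
  case ()

-- Comparing and scaling costs

infix 4 _≼_

_≼_ : Cost → Cost → Set
c ≼ d = work c ≤ work d × span c ≤ span d

scale : ℕ → Cost → Cost
scale m c = ⟨work: m * work c ,span: m * span c ⟩

≼-trans : ∀ {c d e} → c ≼ d → d ≼ e → c ≼ e
≼-trans (w , s) (w′ , s′) = ≤-trans w w′ , ≤-trans s s′

⊕-mono : ∀ {c c′ d d′} → c ≼ c′ → d ≼ d′ → c ⊕ d ≼ c′ ⊕ d′
⊕-mono (w , s) (w′ , s′) = +-mono-≤ w w′ , +-mono-≤ s s′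

steps-mono : ∀ {l m} → l ≤ m → steps l ≼ steps m
steps-mono l≤m = l≤m , l≤m

steps-around : ∀ l m {n} c → l + m ≤ n → steps l ⊕ (c ⊕ steps m) ≼ steps n ⊕ c
steps-around l m {n} c l+m≤n = bound (work c) , bound (span c)
  where
  bound : ∀ o → l + (o + m) ≤ n + o
  bound o = begin
    l + (o + m)  ≡⟨ cong (l +_) (+-comm o m) ⟩
    l + (m + o)  ≡⟨ +-assoc l m o ⟨
    l + m + o    ≤⟨ +-monoˡ-≤ o l+m≤n ⟩
    n + o        ∎
    where open ≤-Reasoning

scale-suc : ∀ t c d → c ⊕ (scale t c ⊕ d) ≼ scale (suc t) c ⊕ d
scale-suc t c d = ≤-reflexive (sym (+-assoc (work c) _ _)) ,
                  ≤-reflexive (sym (+-assoc (span c) _ _))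

-- The loop turns at least once, so the steps outside it can be charged to its turns.
scale-absorb : ∀ t l m n c → l + (m + n) ≤ 200 →
               steps l ⊕ (scale (suc t) c ⊕ steps m ⊕ steps n) ≼ scale (suc t) (steps 200 ⊕ c)
scale-absorb t l m n c ≤200 = bound (work c) , bound (span c)
  where
  bound : ∀ o → l + (suc t * o + m + n) ≤ suc t * (200 + o)
  bound o = begin
    l + (suc t * o + m + n)    ≡⟨ cong (l +_) (trans (+-assoc _ m n) (+-comm _ (m + n))) ⟩
    l + (m + n + suc t * o)    ≡⟨ +-assoc l (m + n) _ ⟨
    l + (m + n) + suc t * o    ≤⟨ +-monoˡ-≤ _ (≤-trans ≤200 (m≤n*m 200 (suc t))) ⟩
    suc t * 200 + suc t * o    ≡⟨ *-distribˡ-+ (suc t) 200 o ⟨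
    suc t * (200 + o)          ∎
    where open ≤-Reasoning

scale-+ : ∀ l m c → scale l c ⊕ scale m c ≼ scale (l + m) c
scale-+ l m c = ≤-reflexive (sym (*-distribʳ-+ (work c) l m)) ,
                ≤-reflexive (sym (*-distribʳ-+ (span c) l m))

-- The program

active chunk found : Reg
active = 9
chunk  = 10
found  = 11

-- The code of a sign doubles as the offset of the LCP length for that sign in the record of a node.
-- `chunkSize` is capped by what remains of either key because the oracle accepts only two slices of
-- exactly the given dimension.
storedLCP nodeDimension chunkBound targetAt nodeAt chunkSize : Expr
minimum : Expr → Expr → Expr
minimum d e   = op monus d (op monus d e)
storedLCP     = load (op add (reg nodeAddr) (reg signIn))
nodeDimension = load (op add (reg nodeAddr) (lit 2))
chunkBound    = op add (lit 1) (op div (reg dimension) (reg known))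
targetAt      = op add (reg xAddr) (reg lcpOut)
nodeAt        = op add (op add (reg nodeAddr) (lit 3)) (reg lcpOut)
chunkSize     = minimum chunkBound (minimum (op monus (reg dimension) (reg lcpOut))
                                            (op monus nodeDimension (reg lcpOut)))

extend settle tie program : Program
extend =
  assign chunk chunkSize ⨾
  lcp found targetAt nodeAt (reg chunk) ⨾
  assign lcpOut (op add (reg lcpOut) (reg found)) ⨾
  -- The test is against the full chunk length, not the size actually used: a chunk cut short by the
  -- end of a key always stops the loop. If a key ends exactly with a full chunk, one more turn on
  -- an empty chunk finds 0 and stops.
  assign active (op same (reg found) chunkBound)
settle =
  ifNonzero (op less (reg lcpOut) (reg dimension))
    (ifNonzero (op less (reg lcpOut) nodeDimension)
      -- The codes are 0 for x before v, 1 for x after v and 2 for equality: from 2, one is taken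
      -- away if the letter of v is smaller, and two if the letter of x is.
      (assign orderOut (op monus (op monus (lit 2) (op less (load nodeAt) (load targetAt)))
                                 (op mul (lit 2) (op less (load targetAt) (load nodeAt)))))
      (assign orderOut (lit 1)))
    (assign orderOut (op monus (lit 2)
                               (op mul (lit 2) (op less (reg lcpOut) nodeDimension))))
tie =
  assign lcpOut (reg lcpIn) ⨾
  assign active (lit 1) ⨾
  whileNonzero (reg active) extend ⨾
  settle
program =
  ifNonzero (op less storedLCP (reg lcpIn))
    (assign lcpOut storedLCP ⨾ assign orderOut (reg signIn))
    (ifNonzero (op less (reg lcpIn) storedLCP)
      (assign lcpOut (reg lcpIn) ⨾ assign orderOut (op monus (lit 1) (reg signIn)))
      tie)

-- Correctness and cost of the program

module Executions {a ℓ₁ ℓ₂} (𝓐 : StrictTotalOrder a ℓ₁ ℓ₂) (oracle : LCPOracle) where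
  open Comparisons 𝓐 renaming (sym to letter)
  open LCPOracle oracle

  Runs : Program → Store → Store → Cost → Set a
  Runs P σ σ′ bound = ∃[ c ] (_⊢_⟶_∣_ oracle P σ σ′ c × c ≼ bound)

  runs-within : ∀ {P σ σ′ c d} → Runs P σ σ′ c → c ≼ d → Runs P σ σ′ d
  runs-within (_ , r , b) c≼d = _ , r , ≼-trans b c≼d

  assign-runs : ∀ {r e σ w} → eval σ 0 e ≡ w →
                Runs (assign r e) σ (σ [ r ≔ w ]) (steps (1 + size e))
  assign-runs refl = _ , assign , ≤-refl , ≤-refl

  infixr 5 _⨟_
  _⨟_ : ∀ {P Q σ σ′ σ″ c d} → Runs P σ σ′ c → Runs Q σ′ σ″ d → Runs (P ⨾ Q) σ σ″ (c ⊕ d)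
  (_ , r , b) ⨟ (_ , r′ , b′) = _ , (r ⨾ r′) , ⊕-mono b b′

  if-yes-runs : ∀ {e P Q σ σ′ c} → eval σ 0 e ≡ num 1 → Runs P σ σ′ c →
                Runs (ifNonzero e P Q) σ σ′ (steps (1 + size e) ⊕ c)
  if-yes-runs e≡1 (_ , r , b) =
    _ , if-yes (cong toNum e≡1) r , ⊕-mono (≤-refl , ≤-refl) b

  if-no-runs : ∀ {e P Q σ σ′ c} → eval σ 0 e ≡ num 0 → Runs Q σ σ′ c →
               Runs (ifNonzero e P Q) σ σ′ (steps (1 + size e) ⊕ c)
  if-no-runs e≡0 (_ , r , b) =
    _ , if-no (cong toNum e≡0) r , ⊕-mono (≤-refl , ≤-refl) b

  eval-load : ∀ {σ} {e} {m} {w} → eval σ 0 e ≡ num m → memory σ m ≡ w → eval σ 0 (load e) ≡ w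
  eval-load {σ} e≡ m≡ = trans (cong (λ w → memory σ (toNum w)) e≡) m≡

  less-yes : ∀ {w z l m} → w ≡ num l → z ≡ num m → l < m → apply less w z ≡ num 1
  less-yes {l = l} {m} refl refl l<m = cong bit (dec-true (l <? m) l<m)

  less-no : ∀ {w z l m} → w ≡ num l → z ≡ num m → ¬ (l < m) → apply less w z ≡ num 0
  less-no {l = l} {m} refl refl l≮m = cong bit (dec-false (l <? m) l≮m)

  Holds-tail : ∀ μ b c y → Holds μ b (c ∷ y) → Holds μ (suc b) y
  Holds-tail μ b c y h i = trans (cong μ (sym (+-suc b (toℕ i)))) (h (suc i))

  Holds-drop : ∀ μ b m y → Holds μ b y → Holds μ (b + m) (drop m y)
  Holds-drop μ b zero    y       h = subst (λ b → Holds μ b y) (sym (+-identityʳ b)) h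
  Holds-drop μ b (suc m) []      h = λ ()
  Holds-drop μ b (suc m) (c ∷ y) h =
    subst (λ b → Holds μ b (drop m y)) (sym (+-suc b m))
          (Holds-drop μ (suc b) m y (Holds-tail μ b c y h))

  Holds-take : ∀ μ b j y → Holds μ b y → Holds μ b (take j y)
  Holds-take μ b zero    _       _ = λ ()
  Holds-take μ b (suc j) []      _ = λ ()
  Holds-take μ b (suc j) (c ∷ y) h zero    = h zero
  Holds-take μ b (suc j) (c ∷ y) h (suc i) =
    trans (cong μ (+-suc b (toℕ i))) (Holds-take μ (suc b) j y (Holds-tail μ b c y h) i)

  module Calls {n} (D : LinkedStructure n) (x : Key) (addr : Fin n → ℕ) (b fₙ : ℕ)
               (κ Kʷ Kˢ : ℕ) (work≤ : ∀ j → workOf j ≤ κ * j + Kʷ)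
               (span≤ : ∀ j → spanOf j ≤ Kˢ) where
    open CommonPrefixes 𝓐
    open Searches 𝓐 D
    open LinkedStructure D
    open Initial
    open InMemory

    q : ℕ
    q = suc (quot (length x) fₙ)

    -- 100 and 200 are generous bounds on the number of steps of an iteration of
    -- the loop besides the oracle's, and of a call outside the loop.
    lcpSteps oracleBound turn round : Cost
    lcpSteps    = steps (1 + size targetAt + size nodeAt + size (reg chunk))
    oracleBound = ⟨work: κ * q + Kʷ ,span: Kˢ ⟩
    turn  = steps 100 ⊕ oracleBound
    round = steps 200 ⊕ turn

    work-round : work round ≡ 300 + (κ + Kʷ) + κ * quot (length x) fₙ
    work-round = cong (300 +_) (begin
      κ * q + Kʷ             ≡⟨ cong (_+ Kʷ) (*-suc κ Q) ⟩
      κ + κ * Q + Kʷ         ≡⟨ +-assoc κ _ Kʷ ⟩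
      κ + (κ * Q + Kʷ)       ≡⟨ cong (κ +_) (+-comm (κ * Q) Kʷ) ⟩
      κ + (Kʷ + κ * Q)       ≡⟨ +-assoc κ Kʷ _ ⟨
      κ + Kʷ + κ * Q         ∎)
      where
      open ≡-Reasoning
      Q = quot (length x) fₙ

    -- The program writes no memory and no register below 4. The form `4 + r` lets the lookups in
    -- registers 0 to 3 reduce by computation.
    Initial-≔ : ∀ {r w σ} → Initial D x addr b fₙ σ →
                Initial D x addr b fₙ (σ [ 4 + r ≔ w ])
    Initial-≔ i = record
      { inMemory   = inMemory i
      ; xAddr≡     = xAddr≡ i
      ; dimension≡ = dimension≡ i
      ; nodeCount≡ = nodeCount≡ i
      ; known≡     = known≡ i
      }

    record AtLoop (v : Fin n) (m : ℕ) (σ : Store) : Set a where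
      field
        initial  : Initial D x addr b fₙ σ
        node≡    : regs σ nodeAddr ≡ num (addr v)
        matched≡ : regs σ lcpOut ≡ num m
    open AtLoop

    module _ {v m σ} (at : AtLoop v m σ) where

      nodeDimension≡ : eval σ 0 nodeDimension ≡ num (length (key v))
      nodeDimension≡ = eval-load {σ} {op add (reg nodeAddr) (lit 2)}
                                 (cong (λ w → apply add w (num 2)) (node≡ at))
                                 (dim (inMemory (initial at)) v)

      targetAt≡ : eval σ 0 targetAt ≡ num (b + m)
      targetAt≡ = cong₂ (apply add) (xAddr≡ (initial at)) (matched≡ at)

      nodeAt≡ : eval σ 0 nodeAt ≡ num (addr v + 3 + m)
      nodeAt≡ = cong₂ (apply add) (cong (λ w → apply add w (num 3)) (node≡ at)) (matched≡ at)

      chunkBound≡ : eval σ 0 chunkBound ≡ num q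
      chunkBound≡ = cong (apply add (num 1))
                      (cong₂ (apply div) (dimension≡ (initial at)) (known≡ (initial at)))

      target-rest : Holds (memory σ) (b + m) (drop m x)
      target-rest = Holds-drop (memory σ) b m x (target (inMemory (initial at)))

      node-rest : Holds (memory σ) (addr v + 3 + m) (drop m (key v))
      node-rest = Holds-drop (memory σ) (addr v + 3) m (key v) (keys (inMemory (initial at)) v)

      private
        X = drop m x
        Y = drop m (key v)
        k = length x ∸ m
        d = length (key v) ∸ m
        j = q ∸ (q ∸ (k ∸ (k ∸ d)))
        r = q ⊓ LCP X Y

      j≡ : j ≡ q ⊓ (length X ⊓ length Y)
      j≡ = begin
        q ∸ (q ∸ (k ∸ (k ∸ d)))       ≡⟨ m∸[m∸n]≡m⊓n q _ ⟩
        q ⊓ (k ∸ (k ∸ d))             ≡⟨ cong (q ⊓_) (m∸[m∸n]≡m⊓n k d) ⟩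
        q ⊓ (k ⊓ d)                   ≡⟨ cong (q ⊓_) (cong₂ _⊓_ (length-drop m x)
                                                               (length-drop m (key v))) ⟨
        q ⊓ (length X ⊓ length Y)     ∎
        where open ≡-Reasoning

      j≤X : j ≤ length X
      j≤X = ≤-trans (≤-reflexive j≡) (≤-trans (m⊓n≤n q _) (m⊓n≤m (length X) _))

      j≤Y : j ≤ length Y
      j≤Y = ≤-trans (≤-reflexive j≡) (≤-trans (m⊓n≤n q _) (m⊓n≤n (length X) _))

      -- The key lengths inside the chunk size disappear because a common prefix is longer than
      -- neither key. Thus the result equals q exactly if a full chunk matches.
      LCP-chunk : LCP (take j X) (take j Y) ≡ r
      LCP-chunk = begin
        LCP (take j X) (take j Y)               ≡⟨ LCP-take j X Y ⟩
        j ⊓ LCP X Y                             ≡⟨ cong (_⊓ LCP X Y) j≡ ⟩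
        q ⊓ (length X ⊓ length Y) ⊓ LCP X Y     ≡⟨ ⊓-assoc q _ _ ⟩
        q ⊓ (length X ⊓ length Y ⊓ LCP X Y)     ≡⟨ cong (q ⊓_) (m≥n⇒m⊓n≡n
                                                     (⊓-glb (LCP≤lengthˡ X Y) (LCP≤lengthʳ X Y))) ⟩
        q ⊓ LCP X Y                             ∎
        where open ≡-Reasoning

      σ₁ σ₂ σ₃ σ₄ : Store
      σ₁ = σ  [ chunk  ≔ num j ]
      σ₂ = σ₁ [ found  ≔ num r ]
      σ₃ = σ₂ [ lcpOut ≔ num (m + r) ]
      σ₄ = σ₃ [ active ≔ bit (r ≡ᵇ q) ]

      lcp-runs : Runs (lcp found targetAt nodeAt (reg chunk)) σ₁ σ₂
                      (lcpSteps ⊕ oracleBound)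
      lcp-runs =
        subst (λ r → Runs _ σ₁ (σ₁ [ found ≔ num r ]) _) LCP-chunk
          (_ , lcp {y = take j X} {z = take j Y}
                   (trans (length-take j X) (m≤n⇒m⊓n≡m j≤X))
                   (subst (λ w → Holds (memory σ) (toNum w) (take j X)) (sym targetAt≡)
                          (Holds-take (memory σ) (b + m) j X target-rest))
                   (trans (length-take j Y) (m≤n⇒m⊓n≡m j≤Y))
                   (subst (λ w → Holds (memory σ) (toNum w) (take j Y)) (sym nodeAt≡)
                          (Holds-take (memory σ) (addr v + 3 + m) j Y node-rest))
             , ⊕-mono {c = lcpSteps} (≤-refl , ≤-refl)
                      ( ≤-trans (work≤ j) (+-monoˡ-≤ Kʷ (*-monoʳ-≤ κ (m∸n≤m q (q ∸ (k ∸ (k ∸ d))))))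
                      , span≤ j))

      extend-runs : Runs extend σ σ₄ (steps 98 ⊕ oracleBound)
      extend-runs = runs-within
        (assign-runs (cong₂ (apply monus) chunkBound≡
                       (cong₂ (apply monus) chunkBound≡
                         (cong₂ (apply monus) dim-m (cong₂ (apply monus) dim-m node-m))))
          ⨟ lcp-runs
          ⨟ assign-runs (cong (λ w → apply add w (num r)) (matched≡ at))
          ⨟ assign-runs (cong (apply same (num r)) chunkBound≡))
        (steps-around (1 + size chunkSize + work lcpSteps)
                      (1 + size (op add (reg lcpOut) (reg found)) +
                       (1 + size (op same (reg found) chunkBound)))
                      {98} oracleBound (≤ᵇ⇒≤ _ _ _))
        where
        dim-m  = cong₂ (apply monus) (dimension≡ (initial at)) (matched≡ at)
        node-m = cong₂ (apply monus) nodeDimension≡ (matched≡ at)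

      at-extended : AtLoop v (m + r) σ₄
      at-extended = record
        { initial  = Initial-≔ {5} (Initial-≔ {4} (Initial-≔ {7} (Initial-≔ {6} (initial at))))
        ; node≡    = node≡ at
        ; matched≡ = refl
        }

      settle-runs : Runs settle σ
        (σ [ orderOut ≔ num (orderCode (order (x [ m ∶ suc m ]) (key v [ m ∶ suc m ]))) ])
        (steps 100)
      -- The slices to be compared have length `suc m ∸ m`; once this is 1, they depend only on
      -- whether each key ends at m and, if not, on its next letter.
      settle-runs rewrite m+n∸n≡m 1 m
        with X | length-drop m x | target-rest | Y | length-drop m (key v) | node-rest
      ... | [] | |X| | _ | [] | |Y| | _ = runs-within
        (if-no-runs (less-no (matched≡ at) (dimension≡ (initial at)) (m∸n≡0⇒≮ |X|))
          (assign-runs (cong (λ w → apply monus (num 2) (apply mul (num 2) w))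
            (less-no (matched≡ at) nodeDimension≡ (m∸n≡0⇒≮ |Y|)))))
        (steps-mono (≤ᵇ⇒≤ _ _ _))
      ... | [] | |X| | _ | c ∷ _ | |Y| | _ = runs-within
        (if-no-runs (less-no (matched≡ at) (dimension≡ (initial at)) (m∸n≡0⇒≮ |X|))
          (assign-runs (cong (λ w → apply monus (num 2) (apply mul (num 2) w))
            (less-yes (matched≡ at) nodeDimension≡ (m∸n≡1+⇒< |Y|)))))
        (steps-mono (≤ᵇ⇒≤ _ _ _))
      ... | c ∷ _ | |X| | _ | [] | |Y| | _ = runs-within
        (if-yes-runs (less-yes (matched≡ at) (dimension≡ (initial at)) (m∸n≡1+⇒< |X|))
          (if-no-runs (less-no (matched≡ at) nodeDimension≡ (m∸n≡0⇒≮ |Y|))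
            (assign-runs refl)))
        (steps-mono (≤ᵇ⇒≤ _ _ _))
      ... | c ∷ _ | |X| | hX | e ∷ _ | |Y| | hY = runs-within
        (if-yes-runs (less-yes (matched≡ at) (dimension≡ (initial at)) (m∸n≡1+⇒< |X|))
          (if-yes-runs (less-yes (matched≡ at) nodeDimension≡ (m∸n≡1+⇒< |Y|))
            (assign-runs (trans (cong₂ comparison c≡ e≡) (compare-letters c e)))))
        (steps-mono (≤ᵇ⇒≤ _ _ _))
        where
        comparison : Word → Word → Word
        comparison w z = apply monus (apply monus (num 2) (apply less z w))
                                     (apply mul (num 2) (apply less w z))

        first-cell : ∀ {p h y} → Holds (memory σ) p (h ∷ y) → memory σ p ≡ letter h
        first-cell {p} h = trans (cong (memory σ) (sym (+-identityʳ p))) (h zero)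

        c≡ : eval σ 0 (load targetAt) ≡ letter c
        c≡ = eval-load {σ} {targetAt} targetAt≡ (first-cell hX)

        e≡ : eval σ 0 (load nodeAt) ≡ letter e
        e≡ = eval-load {σ} {nodeAt} nodeAt≡ (first-cell hY)

        compare-letters : ∀ c e → comparison (letter c) (letter e) ≡
                                  num (orderCode (order (c ∷ []) (e ∷ [])))
        compare-letters c e with 𝓐.compare c e
        ... | tri< _ _ e≮c rewrite dec-false (e 𝓐.<? c) e≮c = refl
        ... | tri≈ _ _ e≮c rewrite dec-false (e 𝓐.<? c) e≮c = refl
        ... | tri> _ _ e<c rewrite dec-true (e 𝓐.<? c) e<c  = refl

    -- The number `g` makes the recursion structural: a full chunk advances m by q ≥ 1. Of the
    -- `suc t` turns only the last fails to match a full chunk, so the other t are covered by the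
    -- growth of m. The two extra steps are the test that leaves the loop.
    loop-runs : ∀ g {v m σ} → LCP x (key v) < m + g → m ≤ LCP x (key v) →
                AtLoop v m σ → regs σ active ≡ num 1 →
                ∃[ t ] ∃[ σ′ ]
                  (Runs (whileNonzero (reg active) extend) σ σ′ (scale (suc t) turn ⊕ steps 2) ×
                   AtLoop v (LCP x (key v)) σ′ × m + t * q ≤ LCP x (key v))
    loop-runs zero    {m = m} lt le _ _ =
      contradiction (≤-trans lt (≤-trans (≤-reflexive (+-identityʳ m)) le)) (n≮n _)
    loop-runs (suc g) {v} {m} {σ} lt le at on = go (q ≤? LCP X Y)
      where
      X = drop m x
      Y = drop m (key v)
      r = q ⊓ LCP X Y
      σ′ = σ₄ at

      split : m + LCP X Y ≡ LCP x (key v)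
      split = LCP-drop m x (key v) le

      c : Cost
      c = proj₁ (extend-runs at)

      extended : _⊢_⟶_∣_ oracle extend σ σ′ c
      extended = proj₁ (proj₂ (extend-runs at))

      turn-bound : steps 2 ⊕ c ≼ turn
      turn-bound = ⊕-mono {steps 2} {steps 2} {c} {steps 98 ⊕ oracleBound}
                          (≤-refl , ≤-refl) (proj₂ (proj₂ (extend-runs at)))

      go : Dec (q ≤ LCP X Y) → _
      go (yes q≤) =
        let r≡q = m≤n⇒m⊓n≡m q≤
            t , σ″ , (d , rest , bound) , at″ , le′ =
              loop-runs g {v} {m + q} {σ′}
                (≤-trans lt (≤-trans (+-monoʳ-≤ m (+-monoˡ-≤ g (s≤s z≤n)))
                                     (≤-reflexive (sym (+-assoc m q g)))))
                (≤-trans (+-monoʳ-≤ m q≤) (≤-reflexive split))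
                (subst (λ r → AtLoop v (m + r) σ′) r≡q (at-extended at))
                (cong bit (dec-true (r ≟ q) r≡q))
        in suc t , σ″ ,
           (steps 2 ⊕ c ⊕ d , while-yes (cong toNum on) extended rest ,
            ≼-trans (⊕-mono {steps 2 ⊕ c} {turn} turn-bound bound)
                    (scale-suc (suc t) turn (steps 2))) ,
           at″ , ≤-trans (≤-reflexive (sym (+-assoc m q (t * q)))) le′
      go (no q≰) =
        let r≡LCP = m≥n⇒m⊓n≡n (≰⇒≥ q≰)
        in 0 , σ′ ,
           (steps 2 ⊕ c ⊕ steps 2 ,
            while-yes (cong toNum on) extended
              (while-no (cong (λ b → toNum (bit b))
                (dec-false (r ≟ q) (λ r≡q → q≰ (≤-reflexive (trans (sym r≡q) r≡LCP)))))) ,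
            ⊕-mono {steps 2 ⊕ c} {scale 1 turn} {steps 2}
              (≼-trans turn-bound ( ≤-reflexive (sym (*-identityˡ (work turn)))
                                  , ≤-reflexive (sym (*-identityˡ (span turn)))))
              (≤-refl , ≤-refl)) ,
           subst (λ m → AtLoop v m σ′) (trans (cong (m +_) r≡LCP) split) (at-extended at) ,
           ≤-trans (≤-reflexive (+-identityʳ m)) le

    signCode-opposite : ∀ s → 1 ∸ signCode s ≡ orderCode (ord (opposite s))
    signCode-opposite Sign.- = refl
    signCode-opposite Sign.+ = refl

    -- Besides one round of its own, a call costs one for each of its t full chunks. The disjunction
    -- cannot be dropped: if the stored length is below `lcpAt`, then x and v share less than
    -- `lcpAt`, so the second alternative fails even for t = 0.
    Answers : Fin n → Store → Order × ℕ → Set a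
    Answers v τ r = ∃[ t ] ∃[ τ′ ]
      (Runs program (pass D x addr v τ) τ′ (scale (suc t) round) ×
       Initial D x addr b fₙ τ′ ×
       (t * q ≡ 0 ⊎ lcpAt D x v + t * q ≤ LCP x (key v)) ×
       regs τ′ orderOut ≡ num (orderCode (proj₁ r)) ×
       regs τ′ lcpOut ≡ num (proj₂ r))

    call : ∀ v τ → Initial D x addr b fₙ τ →
           Answers v τ (kCompare x v (signAt x v) (lcpAt D x v))
    call v τ init = by-cases (<-cmp ℓₓ ℓᵥ)
      where
      s  = signAt x v
      ℓₓ = lcpAt D x v
      ℓᵥ = ℓ (key v) (πᵖ s v)
      m  = LCP x (key v)
      σ  = pass D x addr v τ

      init-σ : Initial D x addr b fₙ σ
      init-σ = Initial-≔ {2} (Initial-≔ {1} (Initial-≔ {0} init))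

      stored≡ : memory τ (addr v + signCode s) ≡ num ℓᵥ
      stored≡ = lcps (inMemory init) v s

      at-start : AtLoop v ℓₓ (σ [ lcpOut ≔ num ℓₓ ] [ active ≔ num 1 ])
      at-start = record { initial = Initial-≔ {5} (Initial-≔ {4} init-σ)
                        ; node≡ = refl ; matched≡ = refl }

      constant : ∀ {l P τ′} → l ≤ 200 → Runs P σ τ′ (steps l) → Runs P σ τ′ (scale 1 round)
      constant l≤ r = runs-within r
        ( ≤-trans l≤ (≤-trans (m≤m+n 200 (work turn)) (≤-reflexive (sym (*-identityˡ (work round)))))
        , ≤-trans l≤ (≤-trans (m≤m+n 200 (span turn)) (≤-reflexive (sym (*-identityˡ (span round))))))

      by-cases : Tri (ℓₓ < ℓᵥ) (ℓₓ ≡ ℓᵥ) (ℓᵥ < ℓₓ) → Answers v τ (kCompare x v s ℓₓ)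
      by-cases (tri> _ _ ℓᵥ<ℓₓ) = subst (Answers v τ) (sym (kCompare-> x v s ℓᵥ<ℓₓ))
        ( 0 , _
        , constant (≤ᵇ⇒≤ _ 200 _)
            (if-yes-runs (less-yes stored≡ refl ℓᵥ<ℓₓ)
              (assign-runs stored≡ ⨟ assign-runs refl))
        , Initial-≔ {3} (Initial-≔ {4} init-σ) , inj₁ refl , refl , refl)
      by-cases (tri< ℓₓ<ℓᵥ _ ℓᵥ≮ℓₓ) = subst (Answers v τ) (sym (kCompare-< x v s ℓₓ<ℓᵥ))
        ( 0 , _
        , constant (≤ᵇ⇒≤ _ 200 _)
            (if-no-runs (less-no stored≡ refl ℓᵥ≮ℓₓ)
              (if-yes-runs (less-yes refl stored≡ ℓₓ<ℓᵥ)
                (assign-runs refl ⨟ assign-runs (cong num (signCode-opposite s)))))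
        , Initial-≔ {3} (Initial-≔ {4} init-σ) , inj₁ refl , refl , refl)
      by-cases (tri≈ ℓₓ≮ℓᵥ tied ℓᵥ≮ℓₓ) =
        let ℓₓ≤m = lcpAt≤LCP x v tied
            t , σ′ , loop , at , advance =
              loop-runs (suc m) (m≤n+m (suc m) ℓₓ) ℓₓ≤m at-start refl
        in subst (Answers v τ) (sym (kCompare-≡ x v s tied ℓₓ≤m))
          ( t , _
          , runs-within
              (if-no-runs (less-no stored≡ refl ℓᵥ≮ℓₓ)
                (if-no-runs (less-no refl stored≡ ℓₓ≮ℓᵥ)
                  (assign-runs refl ⨟ assign-runs refl ⨟ loop ⨟ settle-runs at)))
              -- 18 steps precede the loop, 2 test its condition at exit
              (scale-absorb t 18 2 100 turn (≤ᵇ⇒≤ 120 200 _))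
          , Initial-≔ {3} (initial at) , inj₂ advance , refl , matched≡ at)

    -- `T` counts the chunks matched in full by all calls so far. The last component is the
    -- amortised bound: these chunks together fit under the potential.
    Performed : Store → List (Fin n) → Set a
    Performed σ vs = ∃[ T ] ∃[ σ′ ] ∃[ cost ]
      (Performs D x oracle program addr b σ vs σ′ cost ×
       Initial D x addr b fₙ σ′ ×
       cost ≼ scale (T + length vs) round ×
       T * q ≤ longest x vs)

    performs-next : ∀ {σ p vs v} → Reaches links x p vs → node p ≡ just v →
                    Performed σ vs → Performed σ (v ∷ vs)
    performs-next {σ} {vs = vs} {v} r np (T , τ , c , ps , init , bound , T*q≤) =
      let t , τ′ , (d , run , d≼) , init′ , advance , order≡ , lcp≡ = call v τ init
      in t + T , τ′ , c ⊕ d , next ps run order≡ lcp≡ (inMemory init′) , init′ ,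
         subst (λ m → c ⊕ d ≼ scale m round) (count t)
           (≼-trans (⊕-mono {c} bound d≼) (scale-+ (T + length vs) (suc t) round)) ,
         (begin
           (t + T) * q              ≡⟨ *-distribʳ-+ q t T ⟩
           t * q + T * q            ≤⟨ +-monoʳ-≤ (t * q) T*q≤ ⟩
           t * q + longest x vs     ≤⟨ longest-advances r np advance ⟩
           longest x (v ∷ vs)       ∎)
      where
      open ≤-Reasoning
      count : ∀ t → T + length vs + suc t ≡ t + T + suc (length vs)
      count t = begin-equality
        T + length vs + suc t      ≡⟨ +-suc (T + length vs) t ⟩
        suc (T + length vs + t)    ≡⟨ cong suc (+-comm (T + length vs) t) ⟩
        suc (t + (T + length vs))  ≡⟨ cong suc (+-assoc t T _) ⟨
        suc (t + T + length vs)    ≡⟨ +-suc (t + T) _ ⟨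
        t + T + suc (length vs)    ∎

    performs-reached : ∀ {σ p vs} → Initial D x addr b fₙ σ → Reaches links x p vs →
                       Performed σ vs
    performs-reached init enter           = 0 , _ , _ , done , init , (z≤n , z≤n) , z≤n
    performs-reached init (follow r np _) = performs-next r np (performs-reached init r)

    performs : ∀ {σ vs} → Initial D x addr b fₙ σ → Compares x vs → Performed σ vs
    performs init none         = performs-reached init enter
    performs init (until r np) = performs-next r np (performs-reached init r)

-- Adding up the costs of all calls

quot*≤ : ∀ {a ℓ₁ ℓ₂} (𝓐 : StrictTotalOrder a ℓ₁ ℓ₂) k f →
         f * Comparisons.quot 𝓐 k f ≤ k
quot*≤ 𝓐 k zero    = z≤n
quot*≤ 𝓐 k (suc f) = ≤-trans (≤-reflexive (*-comm (suc f) _)) (m/n*n≤m k (suc f))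

<*suc-quot : ∀ {a ℓ₁ ℓ₂} (𝓐 : StrictTotalOrder a ℓ₁ ℓ₂) k f .{{_ : NonZero f}} →
             k < f * suc (Comparisons.quot 𝓐 k f)
<*suc-quot 𝓐 k f@(suc _) = begin-strict
  k                      ≡⟨ m≡m%n+[m/n]*n k f ⟩
  k % f + k / f * f      <⟨ +-monoˡ-< _ (m%n<n k f) ⟩
  f + k / f * f          ≡⟨ *-comm f (suc (k / f)) ⟨
  f * suc (k / f)        ∎
  where open ≤-Reasoning

-- With chunks of length 1 + Q at most f of them match, so that G = T + l turns
-- and calls are O(A); as G is also O(f) and f Q ≤ k, G Q is O(k).
overallFactor : (c₁ c₂ κ W S : ℕ) → ℕ
overallFactor c₁ c₂ κ W S = suc c₂ * S + suc c₂ * W + κ * suc c₁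

rounds-bounds : ∀ {A f k T l Q} c₁ c₂ κ W S →
  A ≤ c₁ * f → f ≤ c₂ * A → l ≤ A → T ≤ f → f * Q ≤ k →
  (T + l) * (W + κ * Q) ≤ overallFactor c₁ c₂ κ W S * (k + A) ×
  (T + l) * S ≤ overallFactor c₁ c₂ κ W S * A
rounds-bounds {A} {f} {k} {T} {l} {Q} c₁ c₂ κ W S A≤ f≤ l≤A T≤f fQ≤k = work≤ , span≤
  where
  open ≤-Reasoning
  G = T + l
  c = overallFactor c₁ c₂ κ W S

  G≤A : G ≤ suc c₂ * A
  G≤A = ≤-trans (+-mono-≤ (≤-trans T≤f f≤) l≤A) (≤-reflexive (+-comm (c₂ * A) A))

  G≤f : G ≤ suc c₁ * f
  G≤f = +-mono-≤ T≤f (≤-trans l≤A A≤)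

  G*≤ : ∀ w → G * w ≤ suc c₂ * w * A
  G*≤ w = begin
    G * w               ≤⟨ *-monoˡ-≤ w G≤A ⟩
    suc c₂ * A * w      ≡⟨ *-assoc (suc c₂) A w ⟩
    suc c₂ * (A * w)    ≡⟨ cong (suc c₂ *_) (*-comm A w) ⟩
    suc c₂ * (w * A)    ≡⟨ *-assoc (suc c₂) w A ⟨
    suc c₂ * w * A      ∎

  span≤ : G * S ≤ c * A
  span≤ = ≤-trans (G*≤ S) (*-monoˡ-≤ A
            (≤-trans (m≤m+n (suc c₂ * S) (suc c₂ * W)) (m≤m+n _ (κ * suc c₁))))

  G*Q≤ : G * (κ * Q) ≤ κ * suc c₁ * k
  G*Q≤ = begin
    G * (κ * Q)                ≡⟨ *-assoc G κ Q ⟨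
    G * κ * Q                  ≡⟨ cong (_* Q) (*-comm G κ) ⟩
    κ * G * Q                  ≡⟨ *-assoc κ G Q ⟩
    κ * (G * Q)                ≤⟨ *-monoʳ-≤ κ (*-monoˡ-≤ Q G≤f) ⟩
    κ * (suc c₁ * f * Q)       ≡⟨ cong (κ *_) (*-assoc (suc c₁) f Q) ⟩
    κ * (suc c₁ * (f * Q))     ≤⟨ *-monoʳ-≤ κ (*-monoʳ-≤ (suc c₁) fQ≤k) ⟩
    κ * (suc c₁ * k)           ≡⟨ *-assoc κ (suc c₁) k ⟨
    κ * suc c₁ * k             ∎

  work≤ : G * (W + κ * Q) ≤ c * (k + A)
  work≤ = begin
    G * (W + κ * Q)                           ≡⟨ *-distribˡ-+ G W _ ⟩
    G * W + G * (κ * Q)                       ≤⟨ +-mono-≤ (G*≤ W) G*Q≤ ⟩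
    suc c₂ * W * A + κ * suc c₁ * k           ≤⟨ +-mono-≤ (*-mono-≤ (m≤n+m _ (suc c₂ * S)) (m≤n+m A k))
                                                          (*-monoʳ-≤ (κ * suc c₁) (m≤m+n k A)) ⟩
    (suc c₂ * S + suc c₂ * W) * (k + A) +
      κ * suc c₁ * (k + A)                    ≡⟨ *-distribʳ-+ (k + A) (suc c₂ * S + suc c₂ * W) _ ⟨
    c * (k + A)                               ∎

theorem4p8 : ∀ {a ℓ₁ ℓ₂ : Level} (𝓐 : StrictTotalOrder a ℓ₁ ℓ₂) (oracle : LCPOracle)
    (A f : ℕ → ℕ) → A ∈Θ f →
    let open Comparisons 𝓐 in
    ∃[ P ] ∃[ c ] ∃[ N ]
    (∀ n → N ≤ n → (D : LinkedStructure n) (x : Key) (vs : List (Fin n)) →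
    LinkedStructure.Compares D x vs → length vs ≤ A n →
    (addr : Fin n → ℕ) (b : ℕ) (σ : Store) → Initial D x addr b (f n) σ →
    ∃[ σ′ ] ∃[ cost ]
    (Performs D x oracle P addr b σ vs σ′ cost ×
    span cost ≤ c * A n ×
    work cost ≤ c * (length x + A n)))
theorem4p8 𝓐 oracle A f ((c₁ , N₁ , A≤f) , (c₂ , N₂ , f≤A))
  with eventually⇒everywhere (LCPOracle.workOf∈O oracle)
     | eventually⇒everywhere (LCPOracle.spanOf∈O oracle)
... | κ , Kʷ , work≤ | κˢ , Kˢ , span≤ =
  program , overallFactor c₁ c₂ κ W S , N₁ ⊔ N₂ ,
  λ n N≤n D x vs compares |vs|≤A addr b σ init →
    let open Executions.Calls 𝓐 oracle D x addr b (f n) κ Kʷ (κˢ * 1 + Kˢ) work≤ span≤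
        T , σ′ , cost , performed , _ , cost≼ , T*q≤ = performs init compares
        A≤ = A≤f n (≤-trans (m≤m⊔n N₁ N₂) N≤n)
        work-bound , span-bound =
          rounds-bounds c₁ c₂ κ W S A≤ (f≤A n (≤-trans (m≤n⊔m N₁ N₂) N≤n)) |vs|≤A
            (T≤f D x vs (f n) T (≤-trans |vs|≤A A≤) T*q≤) (quot*≤ 𝓐 (length x) (f n))
    in σ′ , cost , performed ,
       ≤-trans (proj₂ cost≼) span-bound ,
       ≤-trans (proj₁ cost≼)
         (≤-trans (≤-reflexive (cong ((T + length vs) *_) work-round)) work-bound)
  where
  open Comparisons 𝓐
  W = 300 + (κ + Kʷ)
  S = 300 + (κˢ * 1 + Kˢ)

  -- For positive f, T q ≤ k < f q with q the chunk length, and q cancels. For f = 0, where the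
  -- quotient is 0 by convention, there can be no comparison at all, so the potential and with it T
  -- vanish.
  T≤f : ∀ {n} (D : LinkedStructure n) x vs f T → length vs ≤ c₁ * f →
        T * suc (quot (length x) f) ≤ Searches.longest 𝓐 D x vs → T ≤ f
  T≤f D x []      zero      T _     T*q≤ = ≤-trans (m≤m*n T _) T*q≤
  T≤f D x (_ ∷ _) zero      T |vs|≤ _    =
    contradiction (≤-trans |vs|≤ (≤-reflexive (*-zeroʳ c₁))) λ ()
  T≤f D x vs      f@(suc _) T _     T*q≤ = <⇒≤ (*-cancelʳ-< _ T f
    (≤-<-trans (≤-trans T*q≤ (Searches.longest≤length 𝓐 D x vs)) (<*suc-quot 𝓐 (length x) f)))
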